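{- Let $t\ge2$, $N=t+2$, and let $\mathcal{T}_t$ be the set of partitions $\lambda$ with at most $N$ parts of two-class profile. Sending $\lambda$ to its two distinguished residues together with its $t$-quotient is a bijection $$\mathcal{T}_t\xrightarrow{\ \sim\ }\coprod_{0\le r_A<r_B\le t-1}\mathcal{P}_2\times\mathcal{P}_2\times\mathbb{Z}_{\ge0}^{\,t-2},\qquad \lambda\longmapsto\bigl(r_A,r_B;\ \lambda^{(r_A)},\lambda^{(r_B)};\ (m_i)_{i\ne r_A,r_B}\bigr),$$ where $m_i$ is the single part (possibly $0$) of $\lambda^{(i)}$. Under it the $t$-core $\operatorname{core}_t(\lambda)$ depends only on the pair $(r_A,r_B)$, and $$|\lambda|=\bigl|\operatorname{core}_t(\lambda)\bigr|+t\Bigl(\bigl|\lambda^{(r_A)}\bigr|+\bigl|\lambda^{(r_B)}\bigr|+\sum_{i\ne r_A,r_B}m_i\Bigr).$$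
   Context: $\mathcal{P}_2$ is the set of partitions with at most two parts. For $\lambda=(\lambda_1\ge\dots\ge\lambda_N\ge0)$ let $\beta_j=\lambda_j+N-j$ and $\beta(\lambda)=\{\beta_1>\dots>\beta_N\}$. $\lambda$ has two-class profile if exactly two residue classes modulo $t$, called the distinguished residues $r_A<r_B$ in $\{0,\dots,t-1\}$, contain two elements of $\beta(\lambda)$, and every other class contains exactly one. The $t$-quotient $(\lambda^{(0)},\dots,\lambda^{(t-1)})$ is computed from this beta set with $N$ elements: if the elements of $\beta(\lambda)$ congruent to $i$ modulo $t$ are $t\tilde a_1+i>\dots>t\tilde a_{n}+i$, then $\lambda^{(i)}=(\tilde a_1-n+1,\tilde a_2-n+2,\dots,\tilde a_n)$. $\operatorname{core}_t(\lambda)$ is the usual $t$-core, i.e. the partition whose $N$-element beta set has the same number $n_i$ of elements in each residue class $i$, namely $i,i+t,\dots,i+(n_i-1)t$. -}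

module Defs where

open import Data.Bool.Base using (true; false; if_then_else_)
open import Data.Fin.Base as Fin using (Fin; toℕ)
open import Data.Fin.Properties as Fin using ()
open import Data.List.Base
  using (List; []; _∷_; length; map; filter; downFrom; applyDownFrom)
open import Data.List.Properties
  using (length-map; length-applyDownFrom; filter-accept; filter-reject; length-filter)
open import Data.List.Relation.Unary.All as All using (All; []; _∷_)
open import Data.List.Relation.Unary.All.Properties using (all-filter)
open import Data.List.Relation.Unary.Linked as Linked using (Linked; []; [-]; _∷_)
open import Data.List.Relation.Unary.Linked.Properties as Linked using ()
open import Data.Nat.Base
open import Data.Nat.Divisibility using (divides-refl)
open import Data.Nat.DivMod
open import Data.Nat.ListAction using (sum)
open import Data.Nat.Properties
open import Level using (0ℓ)
open import Function.Base using (_∘_; id)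
open import Relation.Binary.Core using (Rel)
open import Relation.Binary.PropositionalEquality
open import Relation.Nullary using (¬_; yes; no; does; recompute)
open import Relation.Unary using (Decidable)
import Algebra.Properties.CommutativeMonoid.Sum +-0-commutativeMonoid as ∑

-- A partition with at most n parts, padded with zeros to exactly n entries.
-- The proofs are irrelevant, so _≡_ compares the entries only.
record Partition (n : ℕ) : Set where
  constructor mkPartition
  field
    parts        : List ℕ
    .length≡n    : length parts ≡ n
    .decreasing≥ : Linked _≥_ parts

open Partition public using (parts)

length-parts : ∀ {n} (p : Partition n) → length (parts p) ≡ n
length-parts {n} (mkPartition ps len _) = recompute (length ps ≟ n) len

decreasing : ∀ {n} (p : Partition n) → Linked _≥_ (parts p)
decreasing (mkPartition ps _ dec) = recompute (Linked.linked? _≥?_ ps) dec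

size : ∀ {n} → Partition n → ℕ
size p = sum (parts p)

-- Used to read λ⁽ⁱ⁾, which has nᵢ entries, as an element of 𝒫₂ or of 𝒫₁
-- once nᵢ is known.
cast : ∀ {m n} → .(m ≡ n) → Partition m → Partition n
cast eq (mkPartition ps len dec) = mkPartition ps (trans len eq) dec

singlePart : Partition 1 → ℕ
singlePart (mkPartition (m ∷ []) _ _) = m
singlePart (mkPartition [] () _)
singlePart (mkPartition (_ ∷ _ ∷ _) () _)

-- Beta sets are represented by their strictly decreasing lists of elements.

-- The number of entries after the j-th one is N − j.
betaList : List ℕ → List ℕ
betaList []       = []
betaList (x ∷ xs) = x + length xs ∷ betaList xs

-- Inverse of betaList on strictly decreasing lists; there the subtraction
-- never truncates, as the j-th of n elements is at least n − j.
unbetaList : List ℕ → List ℕ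
unbetaList []       = []
unbetaList (b ∷ bs) = b ∸ length bs ∷ unbetaList bs

β : ∀ {n} → Partition n → List ℕ
β p = betaList (parts p)

length-betaList : ∀ xs → length (betaList xs) ≡ length xs
length-betaList []       = refl
length-betaList (x ∷ xs) = cong suc (length-betaList xs)

length-unbetaList : ∀ bs → length (unbetaList bs) ≡ length bs
length-unbetaList []       = refl
length-unbetaList (b ∷ bs) = cong suc (length-unbetaList bs)

betaList-decreasing : ∀ {xs} → Linked _≥_ xs → Linked _>_ (betaList xs)
betaList-decreasing []  = []
betaList-decreasing [-] = [-]
betaList-decreasing {x ∷ y ∷ xs} (x≥y ∷ ps) =
  ≤-trans (≤-reflexive (sym (+-suc y (length xs)))) (+-monoˡ-≤ (suc (length xs)) x≥y)
  ∷ betaList-decreasing ps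

unbetaList-decreasing : ∀ {bs} → Linked _>_ bs → Linked _≥_ (unbetaList bs)
unbetaList-decreasing []  = []
unbetaList-decreasing [-] = [-]
unbetaList-decreasing {b ∷ c ∷ bs} (b>c ∷ ps) =
  ∸-monoˡ-≤ (suc (length bs)) b>c ∷ unbetaList-decreasing ps

length≤head : ∀ {b bs} → Linked _>_ (b ∷ bs) → length bs ≤ b
length≤head [-]       = z≤n
length≤head (b>c ∷ ps) = ≤-trans (s≤s (length≤head ps)) b>c

betaList-unbetaList : ∀ {bs} → Linked _>_ bs → betaList (unbetaList bs) ≡ bs
betaList-unbetaList {[]}     _  = refl
betaList-unbetaList {b ∷ bs} ps = cong₂ _∷_
  (trans (cong (b ∸ length bs +_) (length-unbetaList bs)) (m∸n+n≡m (length≤head ps)))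
  (betaList-unbetaList (Linked.tail ps))

fromBeta : ∀ {n} (bs : List ℕ) → .(length bs ≡ n) → .(Linked _>_ bs) → Partition n
fromBeta bs len dec =
  mkPartition (unbetaList bs) (trans (length-unbetaList bs) len) (unbetaList-decreasing dec)

module _ (t : ℕ) .{{_ : NonZero t}} where

  inClass? : (i : Fin t) → Decidable (λ b → b % t ≡ toℕ i)
  inClass? i b = b % t ≟ toℕ i

  classList : Fin t → List ℕ → List ℕ
  classList i = filter (inClass? i)

  residueClass : ∀ {n} → Partition n → Fin t → List ℕ
  residueClass p i = classList i (β p)

  count : ∀ {n} → Partition n → Fin t → ℕ
  count p i = length (residueClass p i)

  /-mono-< : ∀ {b c r} → b > c → b % t ≡ r → c % t ≡ r → b / t > c / t
  /-mono-< {b} {c} b>c b%t c%t = ≰⇒> λ b/t≤c/t → <⇒≱ b>c (begin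
    b                  ≡⟨ m≡m%n+[m/n]*n b t ⟩
    b % t + b / t * t  ≡⟨ cong (_+ b / t * t) (trans b%t (sym c%t)) ⟩
    c % t + b / t * t  ≤⟨ +-monoʳ-≤ (c % t) (*-monoˡ-≤ t b/t≤c/t) ⟩
    c % t + c / t * t  ≡⟨ m≡m%n+[m/n]*n c t ⟨
    c                  ∎)
    where open ≤-Reasoning

  map-/-decreasing : ∀ {r bs} → Linked _>_ bs → All (λ b → b % t ≡ r) bs →
                     Linked _>_ (map (_/ t) bs)
  map-/-decreasing []         _             = []
  map-/-decreasing [-]        _             = [-]
  map-/-decreasing (b>c ∷ ps) (e ∷ f ∷ es) =
    /-mono-< b>c e f ∷ map-/-decreasing ps (f ∷ es)

  -- The component λ⁽ⁱ⁾: for b = t ã + i in the i-th class, ã = b / t.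
  quotient : ∀ {n} (p : Partition n) (i : Fin t) → Partition (count p i)
  quotient p i = fromBeta (map (_/ t) (residueClass p i))
    (length-map (_/ t) (residueClass p i))
    (map-/-decreasing
      (Linked.filter⁺ (inClass? i) (λ b>c c>d → <-trans c>d b>c)
        (betaList-decreasing (decreasing p)))
      (all-filter (inClass? i) (β p)))

  -- As a set: i, i + t, …, i + (nᵢ − 1) t for each class i, where nᵢ = count p i.
  -- All of these are below n t, since nᵢ ≤ n.
  inCore? : ∀ {n} (p : Partition n) →
            Decidable (λ b → b / t < count p (b mod t))
  inCore? p b = b / t <? count p (b mod t)

  coreBeta : ∀ {n} → Partition n → List ℕ
  coreBeta {n} p = filter (inCore? p) (downFrom (n * t))

  coreBeta-decreasing : ∀ {n} (p : Partition n) → Linked _>_ (coreBeta p)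
  coreBeta-decreasing {n} p = Linked.filter⁺ (inCore? p) (λ b>c c>d → <-trans c>d b>c)
    (Linked.applyDownFrom⁺₂ id (n * t) n<1+n)

  private
    δ : ℕ → ∀ {n} → Fin n → ℕ
    δ r i = if does (r ≟ toℕ i) then 1 else 0

    sum-δ : ∀ {n r} → r < n → ∑.sum (δ r {n}) ≡ 1
    sum-δ {suc n} {zero}  _         = cong suc (∑.sum-replicate-zero n)
    sum-δ {suc n} {suc r} (s≤s r<n) = sum-δ r<n

    length-classList-∷ : ∀ b bs i → length (classList i (b ∷ bs)) ≡
                                    δ (b % t) i + length (classList i bs)
    length-classList-∷ b bs i with does (b % t ≟ toℕ i)
    ... | true  = refl
    ... | false = refl

  sum-length-classList : ∀ bs → ∑.sum (λ i → length (classList i bs)) ≡ length bs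
  sum-length-classList []       = ∑.sum-replicate-zero t
  sum-length-classList (b ∷ bs) = begin
    ∑.sum (λ i → length (classList i (b ∷ bs)))
      ≡⟨ ∑.sum-cong-≗ {t} (length-classList-∷ b bs) ⟩
    ∑.sum {t} (λ i → δ (b % t) i + length (classList i bs))
      ≡⟨ ∑.∑-distrib-+ {t} (δ (b % t)) (λ i → length (classList i bs)) ⟩
    ∑.sum {t} (δ (b % t)) + ∑.sum (λ i → length (classList i bs))
      ≡⟨ cong₂ _+_ (sum-δ {t} (m%n<n b t)) (sum-length-classList bs) ⟩
    suc (length bs) ∎
    where open ≡-Reasoning

  sum-count : ∀ {n} (p : Partition n) → ∑.sum (count p) ≡ n
  sum-count p = trans (sum-length-classList (β p))
                      (trans (length-betaList (parts p)) (length-parts p))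

  count≤n : ∀ {n} (p : Partition n) i → count p i ≤ n
  count≤n p i = ≤-trans (length-filter (inClass? i) (β p))
    (≤-reflexive (trans (length-betaList (parts p)) (length-parts p)))

  classList-coreBeta : ∀ {n} (p : Partition n) i →
    classList i (coreBeta p) ≡ applyDownFrom (λ k → toℕ i + k * t) (count p i)
  classList-coreBeta {n} p i =
    trans (go n) (cong (applyDownFrom f) (m≥n⇒m⊓n≡n (count≤n p i)))
    where
    f : ℕ → ℕ
    f k = toℕ i + k * t

    F : List ℕ → List ℕ
    F = classList i ∘ filter (inCore? p)

    [s+Mt]%t : ∀ {s} M → s < t → (s + M * t) % t ≡ s
    [s+Mt]%t {s} M s<t = trans ([m+kn]%n≡m%n s M t) (m<n⇒m%n≡m s<t)

    [s+Mt]/t : ∀ {s} M → s < t → (s + M * t) / t ≡ M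
    [s+Mt]/t {s} M s<t = trans (+-distrib-/-∣ʳ s (divides-refl M))
      (cong₂ _+_ (m<n⇒m/n≡0 s<t) (m*n/n≡m M t))

    [i+Mt]mod : ∀ M → f M mod t ≡ i
    [i+Mt]mod M = Fin.toℕ-injective
      (trans (Fin.toℕ-fromℕ< _) ([s+Mt]%t M (Fin.toℕ<n i)))

    skip : ∀ {b} bs → b % t ≢ toℕ i → F (b ∷ bs) ≡ F bs
    skip {b} bs ne with does (inCore? p b)
    ... | true  = filter-reject (inClass? i) ne
    ... | false = refl

    drop : ∀ {b} bs → ¬ (b / t < count p (b mod t)) → F (b ∷ bs) ≡ F bs
    drop bs ¬q = cong (classList i) (filter-reject (inCore? p) ¬q)

    keep : ∀ {b} bs → b % t ≡ toℕ i → b / t < count p (b mod t) → F (b ∷ bs) ≡ b ∷ F bs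
    keep bs e q = trans (cong (classList i) (filter-accept (inCore? p) q))
                        (filter-accept (inClass? i) e)

    below : ∀ M s → s ≤ toℕ i → F (downFrom (s + M * t)) ≡ F (downFrom (M * t))
    below M zero    _   = refl
    below M (suc s) s<i = trans
      (skip _ λ e → <⇒≢ s<i (trans (sym ([s+Mt]%t M (<-trans s<i (Fin.toℕ<n i)))) e))
      (below M s (<⇒≤ s<i))

    above : ∀ M s → toℕ i < s → s ≤ t →
            F (downFrom (s + M * t)) ≡ F (downFrom (suc (toℕ i) + M * t))
    above M (suc s) i<1+s s<t with toℕ i ≟ s
    ... | yes refl = refl
    ... | no i≢s   = trans
      (skip _ λ e → i≢s (trans (sym e) ([s+Mt]%t M s<t)))
      (above M s (≤∧≢⇒< (s≤s⁻¹ i<1+s) i≢s) (<⇒≤ s<t))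

    step : ∀ M → F (downFrom (suc M * t)) ≡ F (f M ∷ downFrom (M * t))
    step M with above M t (Fin.toℕ<n i) ≤-refl | inCore? p (f M)
    ... | e | yes q = trans e (trans (keep _ ([s+Mt]%t M (Fin.toℕ<n i)) q)
      (trans (cong (f M ∷_) (below M (toℕ i) ≤-refl))
             (sym (keep _ ([s+Mt]%t M (Fin.toℕ<n i)) q))))
    ... | e | no ¬q = trans e (trans (drop _ ¬q)
      (trans (below M (toℕ i) ≤-refl) (sym (drop _ ¬q))))

    go : ∀ M → F (downFrom (M * t)) ≡ applyDownFrom f (M ⊓ count p i)
    go zero    = refl
    go (suc M) with M <? count p i
    ... | yes q = trans (step M) (trans
      (keep _ ([s+Mt]%t M (Fin.toℕ<n i))
        (subst₂ _<_ (sym ([s+Mt]/t M (Fin.toℕ<n i))) (cong (count p) (sym ([i+Mt]mod M))) q))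
      (trans (cong (f M ∷_) (trans (go M) (cong (applyDownFrom f) (m≤n⇒m⊓n≡m (<⇒≤ q)))))
             (sym (cong (applyDownFrom f) (m≤n⇒m⊓n≡m q)))))
    ... | no ¬q = trans (step M) (trans
      (drop _ λ q → ¬q (subst₂ _<_ ([s+Mt]/t M (Fin.toℕ<n i)) (cong (count p) ([i+Mt]mod M)) q))
      (trans (go M) (cong (applyDownFrom f) (trans (m≥n⇒m⊓n≡n (≮⇒≥ ¬q))
        (sym (m≥n⇒m⊓n≡n (m≤n⇒m≤1+n (≮⇒≥ ¬q))))))))

  length-coreBeta : ∀ {n} (p : Partition n) → length (coreBeta p) ≡ n
  length-coreBeta p = trans (sym (sum-length-classList (coreBeta p))) (trans
    (∑.sum-cong-≗ {t} λ i →
      trans (cong length (classList-coreBeta p i)) (length-applyDownFrom _ (count p i)))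
    (sum-count p))

  core : ∀ {n} → Partition n → Partition n
  core p = fromBeta (coreBeta p) (length-coreBeta p) (coreBeta-decreasing p)

  residueClass-core : ∀ {n} (p : Partition n) i →
    residueClass (core p) i ≡ applyDownFrom (λ k → toℕ i + k * t) (count p i)
  residueClass-core p i = trans
    (cong (classList i) (betaList-unbetaList (coreBeta-decreasing p)))
    (classList-coreBeta p i)

  record TwoClassProfile {n} (p : Partition n) : Set where
    field
      rA rB     : Fin t
      rA<rB     : rA Fin.< rB
      count-rA  : count p rA ≡ 2
      count-rB  : count p rB ≡ 2
      count-one : ∀ i → i ≢ rA → i ≢ rB → count p i ≡ 1

  -- The set 𝒯ₜ. The profile is unique when it exists, and elements are
  -- identified when their underlying partitions agree.
  record TwoClassPartition : Set where
    field
      shape   : Partition (t + 2)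
      profile : TwoClassProfile shape

    open TwoClassProfile profile public

  _≈ᵀ_ : Rel TwoClassPartition 0ℓ
  x ≈ᵀ y = TwoClassPartition.shape x ≡ TwoClassPartition.shape y

  -- The coproduct over pairs rA < rB; the factor of nonnegative integers is
  -- the set of families (mᵢ) indexed by the t − 2 residues i ≠ rA, rB.
  record QuotientData : Set where
    field
      rA rB : Fin t
      rA<rB : rA Fin.< rB
      μA μB : Partition 2
      m     : ∀ i → .(i ≢ rA) → .(i ≢ rB) → ℕ

    -- mᵢ for i ≠ rA, rB, and 0 for the two excluded residues.
    m₀ : Fin t → ℕ
    m₀ i with i Fin.≟ rA | i Fin.≟ rB
    ... | no i≢A | no i≢B = m i i≢A i≢B
    ... | _      | _      = 0

    sum-m : ℕ
    sum-m = ∑.sum m₀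

  record _≈ᵟ_ (x y : QuotientData) : Set where
    private
      module X = QuotientData x
      module Y = QuotientData y
    field
      rA≡ : X.rA ≡ Y.rA
      rB≡ : X.rB ≡ Y.rB
      μA≡ : X.μA ≡ Y.μA
      μB≡ : X.μB ≡ Y.μB
      m≡  : ∀ i .(i≢XA : i ≢ X.rA) .(i≢XB : i ≢ X.rB) .(i≢YA : i ≢ Y.rA) .(i≢YB : i ≢ Y.rB) →
            X.m i i≢XA i≢XB ≡ Y.m i i≢YA i≢YB

  quotientData : TwoClassPartition → QuotientData
  quotientData x = record
    { rA    = rA
    ; rB    = rB
    ; rA<rB = rA<rB
    ; μA    = cast count-rA (quotient shape rA)
    ; μB    = cast count-rB (quotient shape rB)
    ; m     = λ i i≢A i≢B → singlePart (cast (count-one i i≢A i≢B) (quotient shape i))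
    }
    where open TwoClassPartition x

{-# OPTIONS --safe #-}
-- A strictly decreasing list is determined by its members, hence a beta set by
-- its residue classes; the class of i is the image of the beta set of λ⁽ⁱ⁾
-- under a ↦ i + a t. So λ is determined by its quotient, and conversely the
-- union of such images over all i is the beta set of the required λ. Summing
-- the elements of the beta sets of λ and of its core class by class, the two
-- totals differ by t ∑ᵢ |λ⁽ⁱ⁾|.
module Submission where

open import Defs
open import Data.Nat using (ℕ; NonZero; _+_; _*_; _≤_)
open import Data.Product using (_×_)
open import Function.Structures using (IsBijection)
open import Relation.Binary.PropositionalEquality using (_≡_)

open import Data.Empty using (⊥-elim-irr)
open import Data.Fin.Base as Fin using (Fin; toℕ; zero; suc; punchIn)
open import Data.Fin.Properties as Fin using ()
open import Data.List.Base
  using (List; []; _∷_; length; map; filter; downFrom; applyDownFrom)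
open import Data.List.Membership.DecPropositional Data.Nat._≟_ using (_∈?_)
open import Data.List.Membership.Propositional using (_∈_)
open import Data.List.Membership.Propositional.Properties
  using (∈-filter⁺; ∈-filter⁻; ∈-downFrom⁺)
open import Data.List.Properties
  using (length-map; filter-accept; filter-reject; filter-≐; map-∘; map-id-local; ∷-injectiveˡ)
open import Data.List.Relation.Unary.All as All using (All)
open import Data.List.Relation.Unary.All.Properties as All using (all-filter)
open import Data.List.Relation.Unary.AllPairs using (AllPairs; []; _∷_)
open import Data.List.Relation.Unary.Any using (here; there)
open import Data.List.Relation.Unary.Linked as Linked using (Linked)
open import Data.List.Relation.Unary.Linked.Properties as Linked using ()
open import Data.Nat.Base hiding (ℕ; NonZero; _+_; _*_; _≤_)
open import Data.Nat.Divisibility using (divides-refl)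
open import Data.Nat.DivMod
open import Data.Nat.ListAction using (sum)
open import Data.Nat.Properties
open import Data.Nat.Tactic.RingSolver using (solve-∀)
open import Data.Product using (_,_; proj₁; proj₂)
open import Data.Sum.Base using (_⊎_; inj₁; inj₂)
open import Data.Vec.Functional using (updateAt)
open import Data.Vec.Functional.Properties using (updateAt-updates; updateAt-minimal)
open import Function.Base using (_∘_; const; id)
open import Function.Definitions using (Congruent; Injective; Surjective)
open import Relation.Binary.PropositionalEquality
open import Relation.Binary.Structures using (IsEquivalence)
import Relation.Binary.Construct.On as On
open import Relation.Nullary using (yes; no; contradiction)
open import Relation.Unary using (Decidable)
import Algebra.Properties.CommutativeMonoid.Sum +-0-commutativeMonoid as ∑
import Algebra.Properties.Semiring.Sum +-*-semiring as ∑*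

-- Strictly decreasing lists and finite sums.

>-trans : ∀ {a b c} → a > b → b > c → a > c
>-trans a>b b>c = <-trans b>c a>b

-- The head of each list is its maximum and a member of the other list, so the heads agree by
-- antisymmetry. All other members are smaller than the head, hence both inclusions restrict to the
-- tails.
decreasing-≡ : ∀ {xs ys} → Linked _>_ xs → Linked _>_ ys →
               (∀ {b} → b ∈ xs → b ∈ ys) → (∀ {b} → b ∈ ys → b ∈ xs) → xs ≡ ys
decreasing-≡ dec-xs dec-ys = go (Linked.Linked⇒AllPairs >-trans dec-xs)
                                (Linked.Linked⇒AllPairs >-trans dec-ys)
  where
  ∈⇒≤head : ∀ {x y ys} → All (y >_) ys → x ∈ y ∷ ys → x ≤ y
  ∈⇒≤head _   (here refl) = ≤-refl
  ∈⇒≤head y>s (there x∈)  = <⇒≤ (All.lookup y>s x∈)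

  ∈-tail : ∀ {x b : ℕ} {ys} → x > b → b ∈ x ∷ ys → b ∈ ys
  ∈-tail x>b (here refl) = contradiction x>b (<-irrefl refl)
  ∈-tail _   (there b∈)  = b∈

  go : ∀ {xs ys} → AllPairs _>_ xs → AllPairs _>_ ys →
       (∀ {b} → b ∈ xs → b ∈ ys) → (∀ {b} → b ∈ ys → b ∈ xs) → xs ≡ ys
  go []          []          _ _ = refl
  go []          (_ ∷ _)     _ g with () ← g (here refl)
  go (_ ∷ _)     []          f _ with () ← f (here refl)
  go (x>s ∷ dxs) (y>s ∷ dys) f g
    with refl ← ≤-antisym (∈⇒≤head y>s (f (here refl))) (∈⇒≤head x>s (g (here refl)))
    = cong (_ ∷_) (go dxs dys
        (λ b∈ → ∈-tail (All.lookup x>s b∈) (f (there b∈)))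
        (λ b∈ → ∈-tail (All.lookup y>s b∈) (g (there b∈))))

∈⇒≤sum : ∀ {x xs} → x ∈ xs → x ≤ sum xs
∈⇒≤sum {xs = _ ∷ xs} (here refl) = m≤m+n _ (sum xs)
∈⇒≤sum {xs = y ∷ _}  (there x∈)  = m≤n⇒m≤o+n y (∈⇒≤sum x∈)

≤-∑ : ∀ {n} (f : Fin n → ℕ) i → f i ≤ ∑.sum f
≤-∑ f zero    = m≤m+n (f zero) _
≤-∑ f (suc i) = m≤n⇒m≤o+n (f zero) (≤-∑ (f ∘ suc) i)

-- The exceptional summand has the form `x + g a`, so that the change in the sum is stated without
-- subtraction.
∑-except : ∀ {n} {f g : Fin n → ℕ} {x} a → f a ≡ x + g a → (∀ i → i ≢ a → f i ≡ g i) →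
           ∑.sum f ≡ x + ∑.sum g
∑-except {suc n} {f} {g} {x} a fa≡ f≡g = begin
  ∑.sum f                               ≡⟨ ∑.sum-remove {i = a} f ⟩
  f a + ∑.sum (f ∘ punchIn a)           ≡⟨ cong₂ _+_ fa≡ (∑.sum-cong-≗ λ j → f≡g _ (Fin.punchInᵢ≢i a j)) ⟩
  x + g a + ∑.sum (g ∘ punchIn a)       ≡⟨ +-assoc x (g a) _ ⟩
  x + (g a + ∑.sum (g ∘ punchIn a))     ≡⟨ cong (x +_) (∑.sum-remove {i = a} g) ⟨
  x + ∑.sum g                           ∎
  where open ≡-Reasoning

-- Two applications of `∑-except`, through the family `h` that takes the value of `g` at `a` and
-- those of `f` elsewhere.
∑-except₂ : ∀ {n} {f g : Fin n → ℕ} {x y} a b → a ≢ b → f a ≡ x + g a → f b ≡ y + g b →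
            (∀ i → i ≢ a → i ≢ b → f i ≡ g i) → ∑.sum f ≡ x + y + ∑.sum g
∑-except₂ {n} {f} {g} {x} {y} a b a≢b fa≡ fb≡ f≡g = begin
  ∑.sum f                ≡⟨ ∑-except a fa≡x+ha (λ i i≢a → sym (updateAt-minimal i a f i≢a)) ⟩
  x + ∑.sum h            ≡⟨ cong (x +_) (∑-except b (trans (updateAt-minimal b a f (a≢b ∘ sym)) fb≡) h≡g) ⟩
  x + (y + ∑.sum g)      ≡⟨ +-assoc x y _ ⟨
  x + y + ∑.sum g        ∎
  where
  open ≡-Reasoning
  h : Fin n → ℕ
  h = updateAt f a (const (g a))

  fa≡x+ha : f a ≡ x + h a
  fa≡x+ha = trans fa≡ (cong (x +_) (sym (updateAt-updates a f)))

  h≡g : ∀ i → i ≢ b → h i ≡ g i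
  h≡g i i≢b with i Fin.≟ a
  ... | yes refl = updateAt-updates a f
  ... | no i≢a   = trans (updateAt-minimal i a f i≢a) (f≡g i i≢a i≢b)

∑-1 : ∀ n → ∑.sum {n} (const 1) ≡ n
∑-1 zero    = refl
∑-1 (suc n) = cong suc (∑-1 n)

-- Beta sets and sizes of partitions.

unbetaList-betaList : ∀ xs → unbetaList (betaList xs) ≡ xs
unbetaList-betaList []       = refl
unbetaList-betaList (x ∷ xs) = cong₂ _∷_
  (trans (cong (x + length xs ∸_) (length-betaList xs)) (m+n∸n≡m x (length xs)))
  (unbetaList-betaList xs)

-- The shifts N - j add up to a total depending only on the length, which therefore cancels when two
-- partitions with the same number of entries are compared.
sum-betaList : ∀ xs → sum (betaList xs) ≡ sum xs + sum (downFrom (length xs))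
sum-betaList []       = refl
sum-betaList (x ∷ xs) = begin
  x + length xs + sum (betaList xs)                         ≡⟨ cong (x + length xs +_) (sum-betaList xs) ⟩
  x + length xs + (sum xs + sum (downFrom (length xs)))     ≡⟨ assoc x (length xs) (sum xs) _ ⟩
  x + sum xs + (length xs + sum (downFrom (length xs)))     ∎
  where
  open ≡-Reasoning
  assoc : ∀ x n s d → x + n + (s + d) ≡ x + s + (n + d)
  assoc = solve-∀

parts-injective : ∀ {n} {p q : Partition n} → parts p ≡ parts q → p ≡ q
parts-injective refl = refl

parts-singlePart : (p : Partition 1) → parts p ≡ singlePart p ∷ []
parts-singlePart (mkPartition (_ ∷ []) _ _) = refl
parts-singlePart (mkPartition [] () _)
parts-singlePart (mkPartition (_ ∷ _ ∷ _) () _)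

-- Residue classes of a beta set, and the quotient and core read from them.

module _ (t : ℕ) .{{_ : NonZero t}} where

  -- For fixed `i`, the inverse of `_/ t` on the residue class of `i`.
  encode : Fin t → ℕ → ℕ
  encode i a = toℕ i + a * t

  encode-% : ∀ i a → encode i a % t ≡ toℕ i
  encode-% i a = trans ([m+kn]%n≡m%n (toℕ i) a t) (m<n⇒m%n≡m (Fin.toℕ<n i))

  encode-/ : ∀ i a → encode i a / t ≡ a
  encode-/ i a = trans (+-distrib-/-∣ʳ (toℕ i) (divides-refl a))
    (cong₂ _+_ (m<n⇒m/n≡0 (Fin.toℕ<n i)) (m*n/n≡m a t))

  encode-decode : ∀ {i b} → b % t ≡ toℕ i → encode i (b / t) ≡ b
  encode-decode {i} {b} e = trans (cong (_+ b / t * t) (sym e)) (sym (m≡m%n+[m/n]*n b t))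

  encode-mono-> : ∀ i {a b} → a > b → encode i a > encode i b
  encode-mono-> i a>b = +-monoʳ-< (toℕ i) (*-monoˡ-< t a>b)

  toℕ-mod : ∀ b → toℕ (b mod t) ≡ b % t
  toℕ-mod b = Fin.toℕ-fromℕ< (m%n<n b t)

  mod-unique : ∀ {b i} → b % t ≡ toℕ i → b mod t ≡ i
  mod-unique {b} e = Fin.toℕ-injective (trans (toℕ-mod b) e)

  decreasing-classes-≡ : ∀ {xs ys} → Linked _>_ xs → Linked _>_ ys →
                         (∀ i → classList t i xs ≡ classList t i ys) → xs ≡ ys
  decreasing-classes-≡ dec-xs dec-ys eq = decreasing-≡ dec-xs dec-ys
    (transfer eq) (transfer (sym ∘ eq))
    where
    transfer : ∀ {xs ys} → (∀ i → classList t i xs ≡ classList t i ys) → ∀ {b} → b ∈ xs → b ∈ ys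
    transfer eq {b} b∈ = proj₁ (∈-filter⁻ (inClass? t (b mod t))
      (subst (b ∈_) (eq (b mod t))
        (∈-filter⁺ (inClass? t (b mod t)) b∈ (sym (toℕ-mod b)))))

  -- The head `b` joins the class of `b mod t` and no other, so only that summand changes.
  sum-classList : ∀ bs → ∑.sum (λ i → sum (classList t i bs)) ≡ sum bs
  sum-classList []       = ∑.sum-replicate-zero t
  sum-classList (b ∷ bs) = trans
    (∑-except (b mod t)
      (cong sum (filter-accept (inClass? t (b mod t)) (sym (toℕ-mod b))))
      (λ i i≢ → cong sum (filter-reject (inClass? t i) (i≢ ∘ sym ∘ mod-unique))))
    (cong (b +_) (sum-classList bs))

  decreasing-residueClass : ∀ {n} (p : Partition n) i → Linked _>_ (residueClass t p i)
  decreasing-residueClass p i =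
    Linked.filter⁺ (inClass? t i) >-trans (betaList-decreasing (decreasing p))

  β-quotient : ∀ {n} (p : Partition n) i → β (quotient t p i) ≡ map (_/ t) (residueClass t p i)
  β-quotient p i = betaList-unbetaList
    (map-/-decreasing t (decreasing-residueClass p i) (all-filter (inClass? t i) (β p)))

  -- Dividing by `t` loses no information, as the remainder is `i` throughout the class.
  residueClass-quotient : ∀ {n} (p : Partition n) i →
    residueClass t p i ≡ map (encode i) (β (quotient t p i))
  residueClass-quotient p i = sym (begin
    map (encode i) (β (quotient t p i))                    ≡⟨ cong (map (encode i)) (β-quotient p i) ⟩
    map (encode i) (map (_/ t) (residueClass t p i))       ≡⟨ map-∘ (residueClass t p i) ⟨
    map (encode i ∘ (_/ t)) (residueClass t p i)           ≡⟨ map-id-local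
                                                                (All.map encode-decode (all-filter (inClass? t i) (β p))) ⟩
    residueClass t p i                                     ∎)
    where open ≡-Reasoning

  -- The hypothesis compares `parts` because the components of `p` and `q` have types indexed by
  -- counts that are not yet known to agree.
  quotient-injective : ∀ {n} (p q : Partition n) →
    (∀ i → parts (quotient t p i) ≡ parts (quotient t q i)) → p ≡ q
  quotient-injective p q eq = parts-injective (begin
    parts p             ≡⟨ unbetaList-betaList (parts p) ⟨
    unbetaList (β p)    ≡⟨ cong unbetaList (decreasing-classes-≡
                             (betaList-decreasing (decreasing p))
                             (betaList-decreasing (decreasing q)) classes) ⟩
    unbetaList (β q)    ≡⟨ unbetaList-betaList (parts q) ⟩
    parts q             ∎)
    where
    open ≡-Reasoning
    classes : ∀ i → residueClass t p i ≡ residueClass t q i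
    classes i = trans (residueClass-quotient p i)
      (trans (cong (map (encode i) ∘ betaList) (eq i)) (sym (residueClass-quotient q i)))

  -- `coreBeta` consults the partition only through its counts, so the two filters use equivalent
  -- predicates.
  core-cong : ∀ {n} (p q : Partition n) → (∀ i → count t p i ≡ count t q i) → core t p ≡ core t q
  core-cong {n} p q eq = parts-injective (cong unbetaList
    (filter-≐ (inCore? t p) (inCore? t q)
      ((λ {b} → subst (b / t <_) (eq (b mod t))) , (λ {b} → subst (b / t <_) (sym (eq (b mod t)))))
      (downFrom (n * t))))

  -- The size formula, class by class and then in total.

  sum-encode : ∀ i xs → sum (map (encode i) (betaList xs)) ≡
                        sum (applyDownFrom (encode i) (length xs)) + t * sum xs
  sum-encode i []       = sym (*-zeroʳ t)
  -- The entry `x` contributes `t * x` beyond the core element `encode i (length xs)`.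
  sum-encode i (x ∷ xs) = trans (cong (encode i (x + length xs) +_) (sum-encode i xs))
    (rearrange (toℕ i) x (length xs) t (sum xs) _)
    where
    rearrange : ∀ i x n t s d → i + (x + n) * t + (d + t * s) ≡ i + n * t + d + t * (x + s)
    rearrange = solve-∀

  sum-residueClass : ∀ {n} (p : Partition n) i →
    sum (residueClass t p i) ≡ sum (residueClass t (core t p) i) + t * size (quotient t p i)
  sum-residueClass p i = begin
    sum (residueClass t p i)
      ≡⟨ cong sum (residueClass-quotient p i) ⟩
    sum (map (encode i) (β (quotient t p i)))
      ≡⟨ sum-encode i (parts (quotient t p i)) ⟩
    sum (applyDownFrom (encode i) (length (parts (quotient t p i)))) + t * size (quotient t p i)
      ≡⟨ cong (λ k → sum (applyDownFrom (encode i) k) + t * size (quotient t p i))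
           (length-parts (quotient t p i)) ⟩
    sum (applyDownFrom (encode i) (count t p i)) + t * size (quotient t p i)
      ≡⟨ cong (λ bs → sum bs + t * size (quotient t p i)) (residueClass-core t p i) ⟨
    sum (residueClass t (core t p) i) + t * size (quotient t p i) ∎
    where open ≡-Reasoning

  sum-β : ∀ {n} (p : Partition n) → sum (β p) ≡ size p + sum (downFrom n)
  sum-β p = trans (sum-betaList (parts p))
    (cong (λ k → size p + sum (downFrom k)) (length-parts p))

  -- `p` and its core both have `n` entries, so their sizes differ from the sums of their beta sets
  -- by the same `sum (downFrom n)`, which is added to both sides and then cancelled.
  size-core-quotient : ∀ {n} (p : Partition n) →
    size p ≡ size (core t p) + t * ∑.sum (λ i → size (quotient t p i))
  size-core-quotient {n} p = +-cancelʳ-≡ (sum (downFrom n)) _ _ (begin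
    size p + sum (downFrom n)
      ≡⟨ sum-β p ⟨
    sum (β p)
      ≡⟨ sum-classList (β p) ⟨
    ∑.sum (λ i → sum (residueClass t p i))
      ≡⟨ ∑.sum-cong-≗ (sum-residueClass p) ⟩
    ∑.sum (λ i → sum (residueClass t (core t p) i) + t * size (quotient t p i))
      ≡⟨ ∑.∑-distrib-+ (λ i → sum (residueClass t (core t p) i)) (λ i → t * size (quotient t p i)) ⟩
    ∑.sum (λ i → sum (residueClass t (core t p) i)) + ∑.sum (λ i → t * size (quotient t p i))
      ≡⟨ cong₂ _+_ (trans (sum-classList (β (core t p))) (sum-β (core t p)))
           (sym (∑*.*-distribˡ-sum t (λ i → size (quotient t p i)))) ⟩
    size (core t p) + sum (downFrom n) + t * ∑.sum (λ i → size (quotient t p i))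
      ≡⟨ swap (size (core t p)) _ _ ⟩
    size (core t p) + t * ∑.sum (λ i → size (quotient t p i)) + sum (downFrom n) ∎)
    where
    open ≡-Reasoning
    swap : ∀ c d q → c + d + q ≡ c + q + d
    swap = solve-∀

  -- Quotient data as families of lists.

  private
    module Q = QuotientData

  -- One family over all residues, with lists of length 2 at the distinguished residues and 1
  -- elsewhere. Plain lists avoid a type index that varies with `i`.
  component : QuotientData t → Fin t → List ℕ
  component d i with i Fin.≟ Q.rA d | i Fin.≟ Q.rB d
  ... | yes _  | _      = parts (Q.μA d)
  ... | no _   | yes _  = parts (Q.μB d)
  ... | no i≢A | no i≢B = Q.m d i i≢A i≢B ∷ []

  rA≢rB : ∀ d → Q.rA d ≢ Q.rB d
  rA≢rB d = Fin.<⇒≢ (Q.rA<rB d)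

  -- The index is a variable with an equation, so that the family of one datum can be evaluated at a
  -- residue of another.
  component-rA : ∀ d {i} → i ≡ Q.rA d → component d i ≡ parts (Q.μA d)
  component-rA d {i} i≡A with i Fin.≟ Q.rA d
  ... | yes _  = refl
  ... | no i≢A = contradiction i≡A i≢A

  component-rB : ∀ d {i} → i ≡ Q.rB d → component d i ≡ parts (Q.μB d)
  component-rB d {i} i≡B with i Fin.≟ Q.rA d | i Fin.≟ Q.rB d
  ... | yes i≡A | _      = contradiction (trans (sym i≡A) i≡B) (rA≢rB d)
  ... | no _    | yes _  = refl
  ... | no _    | no i≢B = contradiction i≡B i≢B

  -- The inequalities are irrelevant because `m≡` has to be proved from irrelevant ones.
  component-m : ∀ d {i} .(i≢A : i ≢ Q.rA d) .(i≢B : i ≢ Q.rB d) →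
                component d i ≡ Q.m d i i≢A i≢B ∷ []
  component-m d {i} i≢A i≢B with i Fin.≟ Q.rA d | i Fin.≟ Q.rB d
  ... | yes i≡A | _       = ⊥-elim-irr (i≢A i≡A)
  ... | no _    | yes i≡B = ⊥-elim-irr (i≢B i≡B)
  ... | no _    | no _    = refl

  -- Serves twice: to compare with the quotient of a partition and with the components of an
  -- equivalent datum.
  component-unique : ∀ d (F : Fin t → List ℕ) →
    F (Q.rA d) ≡ parts (Q.μA d) → F (Q.rB d) ≡ parts (Q.μB d) →
    (∀ i (i≢A : i ≢ Q.rA d) (i≢B : i ≢ Q.rB d) → F i ≡ Q.m d i i≢A i≢B ∷ []) →
    ∀ i → component d i ≡ F i
  component-unique d F FA FB Fm i with i Fin.≟ Q.rA d | i Fin.≟ Q.rB d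
  ... | yes refl | _        = sym FA
  ... | no _     | yes refl = sym FB
  ... | no i≢A   | no i≢B   = sym (Fm i i≢A i≢B)

  component-quotientData : ∀ x i →
    component (quotientData t x) i ≡ parts (quotient t (TwoClassPartition.shape x) i)
  component-quotientData x = component-unique (quotientData t x) (parts ∘ quotient t shape)
    -- `cast` keeps the entries, so both distinguished residues hold by `refl`.
    refl refl (λ i i≢A i≢B → parts-singlePart (cast (count-one i i≢A i≢B) (quotient t shape i)))
    where open TwoClassPartition x

  component-cong : ∀ {d e} → _≈ᵟ_ t d e → ∀ i → component d i ≡ component e i
  component-cong {d} {e} d≈e = component-unique d (component e)
    (trans (component-rA e rA≡) (cong parts (sym μA≡)))
    (trans (component-rB e rB≡) (cong parts (sym μB≡)))
    (λ i i≢A i≢B → trans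
      (component-m e (subst (i ≢_) rA≡ i≢A) (subst (i ≢_) rB≡ i≢B))
      (cong (_∷ []) (sym (m≡ i _ _ _ _))))
    where open _≈ᵟ_ d≈e

  -- Evaluating the families at each residue recovers the remaining fields. Together with
  -- `component-cong` this reduces equivalence of data to pointwise equality of lists once the
  -- residues agree.
  ≈ᵟ-fromComponents : ∀ {d e} → Q.rA d ≡ Q.rA e → Q.rB d ≡ Q.rB e →
    (∀ i → component d i ≡ component e i) → _≈ᵟ_ t d e
  ≈ᵟ-fromComponents {d} {e} A≡ B≡ eq = record
    { rA≡ = A≡
    ; rB≡ = B≡
    ; μA≡ = parts-injective (trans (sym (component-rA d refl)) (trans (eq (Q.rA d)) (component-rA e A≡)))
    ; μB≡ = parts-injective (trans (sym (component-rB d refl)) (trans (eq (Q.rB d)) (component-rB e B≡)))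
    ; m≡  = λ i i≢A i≢B i≢A′ i≢B′ → ∷-injectiveˡ
        (trans (sym (component-m d i≢A i≢B)) (trans (eq i) (component-m e i≢A′ i≢B′)))
    }

  -- `m₀` vanishes at both distinguished residues, so comparison with it by `∑-except₂` leaves
  -- exactly the two sizes.
  ∑-component : ∀ d → ∑.sum (sum ∘ component d) ≡ size (Q.μA d) + size (Q.μB d) + Q.sum-m d
  ∑-component d = ∑-except₂ (Q.rA d) (Q.rB d) (rA≢rB d)
    (trans (cong sum (component-rA d refl)) (sym (trans (cong (size (Q.μA d) +_) m₀-rA) (+-identityʳ _))))
    (trans (cong sum (component-rB d refl)) (sym (trans (cong (size (Q.μB d) +_) m₀-rB) (+-identityʳ _))))
    off
    where
    m₀-rA : Q.m₀ d (Q.rA d) ≡ 0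
    m₀-rA with Q.rA d Fin.≟ Q.rA d
    ... | yes _  = refl
    ... | no A≢A = contradiction refl A≢A

    m₀-rB : Q.m₀ d (Q.rB d) ≡ 0
    m₀-rB with Q.rB d Fin.≟ Q.rA d | Q.rB d Fin.≟ Q.rB d
    ... | yes _ | _      = refl
    ... | no _  | yes _  = refl
    ... | no _  | no B≢B = contradiction refl B≢B

    off : ∀ i → i ≢ Q.rA d → i ≢ Q.rB d → sum (component d i) ≡ Q.m₀ d i
    off i i≢A i≢B with i Fin.≟ Q.rA d | i Fin.≟ Q.rB d
    ... | yes i≡A | _       = contradiction i≡A i≢A
    ... | no _    | yes i≡B = contradiction i≡B i≢B
    ... | no _    | no _    = +-identityʳ _

  size-quotientData : ∀ x → let d = quotientData t x; p = TwoClassPartition.shape x in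
    size p ≡ size (core t p) + t * (size (Q.μA d) + size (Q.μB d) + Q.sum-m d)
  size-quotientData x = trans (size-core-quotient p)
    (cong (λ s → size (core t p) + t * s)
      (trans (∑.sum-cong-≗ (cong sum ∘ sym ∘ component-quotientData x))
             (∑-component (quotientData t x))))
    where p = TwoClassPartition.shape x

  -- Counts and uniqueness of the profile.

  open TwoClassProfile

  -- A profile fixes every count: 2 at its two residues and 1 elsewhere. With `core-cong` this makes
  -- the core depend on the pair of residues alone.
  count-cong : ∀ {n} {p q : Partition n} (P : TwoClassProfile t p) (Q : TwoClassProfile t q) →
    rA P ≡ rA Q → rB P ≡ rB Q → ∀ i → count t p i ≡ count t q i
  count-cong {q = q} P Q A≡ B≡ i with i Fin.≟ rA P | i Fin.≟ rB P
  ... | yes refl | _        = trans (count-rA P) (sym (trans (cong (count t q) A≡) (count-rA Q)))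
  ... | no _     | yes refl = trans (count-rB P) (sym (trans (cong (count t q) B≡) (count-rB Q)))
  ... | no i≢A   | no i≢B   = trans (count-one P i i≢A i≢B)
    (sym (count-one Q i (subst (i ≢_) A≡ i≢A) (subst (i ≢_) B≡ i≢B)))

  count≡2⇒distinguished : ∀ {n} {p : Partition n} (P : TwoClassProfile t p) {i} →
    count t p i ≡ 2 → i ≡ rA P ⊎ i ≡ rB P
  count≡2⇒distinguished P {i} two with i Fin.≟ rA P | i Fin.≟ rB P
  ... | yes i≡A | _       = inj₁ i≡A
  ... | no _    | yes i≡B = inj₂ i≡B
  ... | no i≢A  | no i≢B with () ← trans (sym two) (count-one P i i≢A i≢B)

  -- The distinguished residues are those with count 2, and the order `rA < rB` rules out exchanging
  -- them.
  profile-unique : ∀ {n} {p : Partition n} (P Q : TwoClassProfile t p) →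
                   rA P ≡ rA Q × rB P ≡ rB Q
  profile-unique P Q
    with count≡2⇒distinguished Q (count-rA P) | count≡2⇒distinguished Q (count-rB P)
  ... | inj₁ A≡A′ | inj₂ B≡B′ = A≡A′ , B≡B′
  ... | inj₁ A≡A′ | inj₁ B≡A′ = contradiction (trans A≡A′ (sym B≡A′)) (Fin.<⇒≢ (rA<rB P))
  ... | inj₂ A≡B′ | inj₂ B≡B′ = contradiction (trans A≡B′ (sym B≡B′)) (Fin.<⇒≢ (rA<rB P))
  ... | inj₂ A≡B′ | inj₁ B≡A′ =
    contradiction (subst₂ Fin._<_ A≡B′ B≡A′ (rA<rB P)) (Fin.<-asym (rA<rB Q))

  -- Reconstruction of a partition from a prescribed quotient.

  module _ {n} (F : Fin t → List ℕ) (F-decreasing : ∀ i → Linked _≥_ (F i))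
           (∑-length : ∑.sum (length ∘ F) ≡ n) where

    private
      class : Fin t → List ℕ
      class i = map (encode i) (betaList (F i))

      inUnion? : Decidable (λ b → b ∈ class (b mod t))
      inUnion? b = b ∈? class (b mod t)

      -- Filtering a `downFrom` gives a strictly decreasing list without sorting. The range suffices
      -- because no element exceeds the sum of all of them; `suc` is there because `downFrom`
      -- excludes its bound.
      union : List ℕ
      union = filter inUnion? (downFrom (suc (∑.sum (sum ∘ class))))

      union-decreasing : Linked _>_ union
      union-decreasing = Linked.filter⁺ inUnion? >-trans (Linked.applyDownFrom⁺₂ id _ n<1+n)

      class-% : ∀ i → All (λ b → b % t ≡ toℕ i) (class i)
      class-% i = All.map⁺ (All.universal (encode-% i) (betaList (F i)))

      -- Both sides are strictly decreasing, so comparing members suffices; an element `b` of the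
      -- union with residue `i` comes from `class (b mod t)`, which is `class i`.
      classList-union : ∀ i → classList t i union ≡ class i
      classList-union i = decreasing-≡
        (Linked.filter⁺ (inClass? t i) >-trans union-decreasing)
        (Linked.map⁺ (Linked.map (encode-mono-> i) (betaList-decreasing (F-decreasing i))))
        to from
        where
        to : ∀ {b} → b ∈ classList t i union → b ∈ class i
        to {b} b∈ = let b∈union , b%t≡i = ∈-filter⁻ (inClass? t i) {xs = union} b∈ in
          subst (λ j → b ∈ class j) (mod-unique b%t≡i) (proj₂ (∈-filter⁻ inUnion? {xs = downFrom _} b∈union))

        from : ∀ {b} → b ∈ class i → b ∈ classList t i union
        from {b} b∈ = ∈-filter⁺ (inClass? t i)
          (∈-filter⁺ inUnion?
            (∈-downFrom⁺ (s≤s (≤-trans (∈⇒≤sum b∈) (≤-∑ (sum ∘ class) i))))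
            (subst (λ j → b ∈ class j) (sym (mod-unique b%t≡i)) b∈))
          b%t≡i
          where b%t≡i = All.lookup (class-% i) b∈

      length-class : ∀ i → length (class i) ≡ length (F i)
      length-class i = trans (length-map (encode i) (betaList (F i))) (length-betaList (F i))

      length-union : length union ≡ n
      length-union = trans (sym (sum-length-classList t union))
        (trans (∑.sum-cong-≗ λ i → trans (cong length (classList-union i)) (length-class i)) ∑-length)

    fromQuotient : Partition n
    fromQuotient = fromBeta union length-union union-decreasing

    residueClass-fromQuotient : ∀ i → residueClass t fromQuotient i ≡ map (encode i) (betaList (F i))
    residueClass-fromQuotient i =
      trans (cong (classList t i) (betaList-unbetaList union-decreasing)) (classList-union i)

    count-fromQuotient : ∀ i → count t fromQuotient i ≡ length (F i)
    count-fromQuotient i = trans (cong length (residueClass-fromQuotient i)) (length-class i)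

    -- `_/ t` undoes `encode i`, and `unbetaList` undoes `betaList`.
    quotient-fromQuotient : ∀ i → parts (quotient t fromQuotient i) ≡ F i
    quotient-fromQuotient i = begin
      unbetaList (map (_/ t) (residueClass t fromQuotient i))
        ≡⟨ cong (unbetaList ∘ map (_/ t)) (residueClass-fromQuotient i) ⟩
      unbetaList (map (_/ t) (map (encode i) (betaList (F i))))
        ≡⟨ cong unbetaList (map-∘ (betaList (F i))) ⟨
      unbetaList (map ((_/ t) ∘ encode i) (betaList (F i)))
        ≡⟨ cong unbetaList (map-id-local (All.universal (encode-/ i) (betaList (F i)))) ⟩
      unbetaList (betaList (F i))
        ≡⟨ unbetaList-betaList (F i) ⟩
      F i ∎
      where open ≡-Reasoning

  -- The inverse map on quotient data.

  component-decreasing : ∀ d i → Linked _≥_ (component d i)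
  component-decreasing d i with i Fin.≟ Q.rA d | i Fin.≟ Q.rB d
  ... | yes _ | _     = decreasing (Q.μA d)
  ... | no _  | yes _ = decreasing (Q.μB d)
  ... | no _  | no _  = Linked.[-]

  length-component-rA : ∀ d → length (component d (Q.rA d)) ≡ 2
  length-component-rA d = trans (cong length (component-rA d refl)) (length-parts (Q.μA d))

  length-component-rB : ∀ d → length (component d (Q.rB d)) ≡ 2
  length-component-rB d = trans (cong length (component-rB d refl)) (length-parts (Q.μB d))

  ∑-length-component : ∀ d → ∑.sum (length ∘ component d) ≡ t + 2
  ∑-length-component d = begin
    -- Compared with the constant family 1, each distinguished residue has one extra element.
    ∑.sum (length ∘ component d)  ≡⟨ ∑-except₂ {x = 1} {y = 1} (Q.rA d) (Q.rB d) (rA≢rB d)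
                                       (length-component-rA d) (length-component-rB d)
                                       (λ i i≢A i≢B → cong length (component-m d i≢A i≢B)) ⟩
    2 + ∑.sum {t} (const 1)       ≡⟨ cong (2 +_) (∑-1 t) ⟩
    2 + t                         ≡⟨ +-comm 2 t ⟩
    t + 2                         ∎
    where open ≡-Reasoning

  fromQuotientData : QuotientData t → TwoClassPartition t
  fromQuotientData d = record
    { shape   = fromQuotient (component d) (component-decreasing d) (∑-length-component d)
    ; profile = record
      { rA        = Q.rA d
      ; rB        = Q.rB d
      ; rA<rB     = Q.rA<rB d
      ; count-rA  = trans (counts (Q.rA d)) (length-component-rA d)
      ; count-rB  = trans (counts (Q.rB d)) (length-component-rB d)
      ; count-one = λ i i≢A i≢B → trans (counts i) (cong length (component-m d i≢A i≢B))
      }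
    }
    where counts = count-fromQuotient (component d) (component-decreasing d) (∑-length-component d)

  quotientData-fromQuotientData : ∀ d → _≈ᵟ_ t (quotientData t (fromQuotientData d)) d
  quotientData-fromQuotientData d = ≈ᵟ-fromComponents refl refl λ i →
    trans (component-quotientData (fromQuotientData d) i)
          (quotient-fromQuotient (component d) (component-decreasing d) (∑-length-component d) i)

  -- Bijectivity.

  ≈ᵟ-isEquivalence : IsEquivalence (_≈ᵟ_ t)
  ≈ᵟ-isEquivalence = record
    { refl  = ≈ᵟ-fromComponents refl refl (λ _ → refl)
    ; sym   = λ d≈e → ≈ᵟ-fromComponents (sym (rA≡ d≈e)) (sym (rB≡ d≈e))
        (λ i → sym (component-cong d≈e i))
    ; trans = λ d≈e e≈f → ≈ᵟ-fromComponents
        (trans (rA≡ d≈e) (rA≡ e≈f)) (trans (rB≡ d≈e) (rB≡ e≈f))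
        (λ i → trans (component-cong d≈e i) (component-cong e≈f i))
    }
    where open _≈ᵟ_

  quotientData-cong : Congruent (_≈ᵀ_ t) (_≈ᵟ_ t) (quotientData t)
  -- Equal shapes may still carry different profile records, so the residues are matched by
  -- `profile-unique`.
  quotientData-cong {x} {y} refl = ≈ᵟ-fromComponents A≡ B≡ λ i →
    trans (component-quotientData x i) (sym (component-quotientData y i))
    where
    A≡ = proj₁ (profile-unique (TwoClassPartition.profile x) (TwoClassPartition.profile y))
    B≡ = proj₂ (profile-unique (TwoClassPartition.profile x) (TwoClassPartition.profile y))

  -- Equivalent data have equal families of components, and these are the quotients, which determine
  -- the shapes.
  quotientData-injective : Injective (_≈ᵀ_ t) (_≈ᵟ_ t) (quotientData t)
  quotientData-injective {x} {y} dx≈dy = quotient-injective _ _ λ i →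
    trans (sym (component-quotientData x i))
          (trans (component-cong dx≈dy i) (component-quotientData y i))

  quotientData-surjective : Surjective (_≈ᵀ_ t) (_≈ᵟ_ t) (quotientData t)
  -- `Surjective` asks that every `z` equivalent to the preimage be sent to `d`, hence the passage
  -- through congruence.
  quotientData-surjective d = fromQuotientData d , λ {z} z≈ →
    IsEquivalence.trans ≈ᵟ-isEquivalence
      (quotientData-cong {z} {fromQuotientData d} z≈) (quotientData-fromQuotientData d)

  quotientData-isBijection : IsBijection (_≈ᵀ_ t) (_≈ᵟ_ t) (quotientData t)
  quotientData-isBijection = record
    { isInjection = record
      { isCongruent = record
        { cong           = λ {x} {y} → quotientData-cong {x} {y}
        ; isEquivalence₁ = On.isEquivalence TwoClassPartition.shape isEquivalence
        ; isEquivalence₂ = ≈ᵟ-isEquivalence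
        }
      ; injective = λ {x} {y} → quotientData-injective {x} {y}
      }
    ; surjective = quotientData-surjective
    }

proposition3p6 : (t : ℕ) .{{_ : NonZero t}} → 2 ≤ t →
    IsBijection (_≈ᵀ_ t) (_≈ᵟ_ t) (quotientData t)
    × (∀ (x y : TwoClassPartition t) →
    TwoClassPartition.rA x ≡ TwoClassPartition.rA y →
    TwoClassPartition.rB x ≡ TwoClassPartition.rB y →
    core t (TwoClassPartition.shape x) ≡ core t (TwoClassPartition.shape y))
    × (∀ (x : TwoClassPartition t) →
    size (TwoClassPartition.shape x) ≡
    size (core t (TwoClassPartition.shape x))
    + t * (size (QuotientData.μA (quotientData t x))
    + size (QuotientData.μB (quotientData t x))
    + QuotientData.sum-m (quotientData t x)))
proposition3p6 t _ =
  quotientData-isBijection t ,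
  (λ x y A≡ B≡ → core-cong t (TwoClassPartition.shape x) (TwoClassPartition.shape y)
    (count-cong t (TwoClassPartition.profile x) (TwoClassPartition.profile y) A≡ B≡)) ,
  size-quotientData t
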